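{- Let $b$ be a nonzero integer and suppose $0\in\chi(0,b)$. Let $p$ be an odd prime that is a $0$-PL prime relative to $(0,b)$. Then for every integer $q\geq 1$, the star graph $S_{q\pi_p(0,b)+1}$ is a $(0,b)$-FLC graph modulo $p$.
   Context: For integers $a,b$, the $(a,b)$-Fibonacci sequence is $F_0=a$, $F_1=b$, $F_n=F_{n-1}+F_{n-2}$ for $n\ge 2$. $(x/p)$ denotes the Legendre symbol for an odd prime $p$ (equal to $0$ when $p\mid x$). The $(a,b)$-Pisano period $\pi_p(a,b)$ is the smallest positive integer $t$ such that $F_{n+t}\equiv F_n \pmod p$ for all $n\ge 0$. For an odd prime $p$ and $j\in\{ -1,0,1\}$, let $\Lambda_j^p(a,b)=\{\xi\in\{0,1,\ldots,\pi_p(a,b)-1\} : (F_\xi/p)=j\}$. The prime $p$ is a $k$-PL prime ($k$-Pisano-Legendre prime) relative to $(a,b)$ if $k=|\Lambda_1^p(a,b)|-|\Lambda_{ -1}^p(a,b)|-|\Lambda_0^p(a,b)|$. The Pisano set $\chi(a,b)$ is the set of all integers $k$ for which there exists an odd prime $p$ that is a $k$-PL prime relative to $(a,b)$. Let $G$ be a simple connected graph of order (number of vertices) $n$. A bijection $f:V(G)\to\{0,1,\ldots,n-1\}$ is an $(a,b)$-FLC labeling (Fibonacci-Legendre cordial labeling) modulo $p$ if the induced edge labeling $f_p^*:E(G)\to\{0,1\}$, given by $f_p^*(uv)=\frac{1+([F_{f(u)}+F_{f(v)}]/p)}{2}$ if $F_{f(u)}+F_{f(v)}\not\equiv 0\pmod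 p$ and $f_p^*(uv)=0$ otherwise, satisfies $|e_{f_p^*}(0)-e_{f_p^*}(1)|\le 1$, where $e_{f_p^*}(i)$ is the number of edges labeled $i$. A graph admitting such a labeling is an $(a,b)$-FLC graph modulo $p$. The star graph $S_n$ has $n$ vertices $x_0,v_1,\ldots,v_{n-1}$ and edges $x_0v_i$ for $1\le i\le n-1$. -}

module Defs where

open import Data.Fin.Base as Fin using (Fin; zero; suc; toℕ; fromℕ<; combine)
open import Data.Fin.Properties as Fin using (pigeonhole; combine-injective; toℕ-fromℕ<)
open import Data.Integer.Base using (ℤ; +_; 0ℤ; 1ℤ; -1ℤ; _+_; _-_; _*_; -_)
open import Data.Integer.Properties as ℤ using (_≟_)
open import Data.Integer.DivMod using (_/_; _/ℕ_; _%ℕ_; n%ℕd<d; a≡a%ℕn+[a/ℕn]*n)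
open import Data.Integer.Divisibility.Signed
open import Data.Integer.Tactic.RingSolver using (solve-∀)
open import Data.List.Base using (List; length; filter; upTo; allFin; cartesianProduct)
open import Data.Nat.Base as ℕ using (ℕ; zero; suc; NonZero; ∣_-_∣)
open import Data.Nat.Divisibility as ℕ using ()
open import Data.Nat.Induction using (<-rec)
open import Data.Nat.Primality using (Prime; prime⇒nonZero)
open import Data.Nat.Properties as ℕ using (anyUpTo?; ≮⇒≥)
open import Data.Product.Base using (∃; _×_; _,_; proj₁; proj₂)
open import Function.Bundles using (_⤖_; module Bijection)
open import Level using (0ℓ)
open import Relation.Binary.Construct.Closure.ReflexiveTransitive using (Star; ε; _◅_)
open import Relation.Binary.Core using (Rel)
open import Relation.Binary.Definitions using (Decidable; Symmetric)
open import Relation.Binary.PropositionalEquality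
  using (_≡_; refl; sym; trans; cong; subst)
open import Relation.Nullary using (¬_; Dec; yes; no)
open import Relation.Nullary.Decidable using (map′; _×-dec_)
open import Relation.Unary using (Pred)

------------------------------------------------------------------------
-- Congruences

infix 4 _≋_[mod_] _≋?_[mod_]

_≋_[mod_] : ℤ → ℤ → ℕ → Set
x ≋ y [mod m ] = + m ∣ x - y

_≋?_[mod_] : ∀ x y m → Dec (x ≋ y [mod m ])
x ≋? y [mod m ] = + m ∣? x - y

module _ {m : ℕ} where

  -- Abstract to keep the proof terms of the ring solver from unfolding.
  abstract

    ≋-refl : ∀ {x} → x ≋ x [mod m ]
    ≋-refl {x} = divides 0ℤ (ℤ.+-inverseʳ x)

    ≋-sym : ∀ {x y} → x ≋ y [mod m ] → y ≋ x [mod m ]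
    ≋-sym {x} {y} d = subst (+ m ∣_) (lem x y) (∣m⇒∣-m d)
      where
      lem : ∀ x y → - (x - y) ≡ y - x
      lem = solve-∀

    ≋-trans : ∀ {x y z} → x ≋ y [mod m ] → y ≋ z [mod m ] → x ≋ z [mod m ]
    ≋-trans {x} {y} {z} d e = subst (+ m ∣_) (lem x y z) (∣m∣n⇒∣m+n d e)
      where
      lem : ∀ x y z → (x - y) + (y - z) ≡ x - z
      lem = solve-∀

    +-cong-≋ : ∀ {x y u v} → x ≋ y [mod m ] → u ≋ v [mod m ] →
               x + u ≋ y + v [mod m ]
    +-cong-≋ {x} {y} {u} {v} d e = subst (+ m ∣_) (lem x y u v) (∣m∣n⇒∣m+n d e)
      where
      lem : ∀ x y u v → (x - y) + (u - v) ≡ (x + u) - (y + v)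
      lem = solve-∀

    +-cancelˡ-≋ : ∀ {x y u v} → x ≋ y [mod m ] → x + u ≋ y + v [mod m ] →
                  u ≋ v [mod m ]
    +-cancelˡ-≋ {x} {y} {u} {v} d e = subst (+ m ∣_) (lem x y u v) (∣m∣n⇒∣m-n e d)
      where
      lem : ∀ x y u v → ((x + u) - (y + v)) - (x - y) ≡ u - v
      lem = solve-∀

    square-cong-≋ : ∀ {x y} → x ≋ y [mod m ] → x * x ≋ y * y [mod m ]
    square-cong-≋ {x} {y} d = subst (+ m ∣_) (lem x y) (∣n⇒∣m*n (x + y) d)
      where
      lem : ∀ x y → (x + y) * (x - y) ≡ x * x - y * y
      lem = solve-∀

module _ (m : ℕ) .{{_ : NonZero m}} where

  residue : ℤ → Fin m
  residue x = fromℕ< (n%ℕd<d x m)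

  abstract

    residue-≋ : ∀ x → x ≋ + toℕ (residue x) [mod m ]
    residue-≋ x = subst (λ r → + m ∣ x - + r) (sym (toℕ-fromℕ< (n%ℕd<d x m)))
      (divides (x /ℕ m) (trans (cong (_- + (x %ℕ m)) (a≡a%ℕn+[a/ℕn]*n x m))
                               (lem (+ (x %ℕ m)) ((x /ℕ m) * + m))))
      where
      lem : ∀ r s → (r + s) - r ≡ s
      lem = solve-∀

    residue-≡⇒≋ : ∀ {x y} → residue x ≡ residue y → x ≋ y [mod m ]
    residue-≡⇒≋ {x} {y} eq =
      ≋-trans {x = x} {y = + toℕ (residue x)} (residue-≋ x)
        (subst (λ r → + toℕ r ≋ y [mod m ]) (sym eq)
          (≋-sym {x = y} (residue-≋ y)))

------------------------------------------------------------------------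
-- Fibonacci sequences and Pisano periods

fib : ℤ → ℤ → ℕ → ℤ
fib a b zero          = a
fib a b (suc zero)    = b
fib a b (suc (suc n)) = fib a b (suc n) + fib a b n

IsPeriod : ℕ → ℤ → ℤ → ℕ → Set
IsPeriod m a b t = ∀ n → fib a b (n ℕ.+ t) ≋ fib a b n [mod m ]

record IsPisanoPeriod (m : ℕ) (a b : ℤ) (t : ℕ) : Set where
  field
    positive : 1 ℕ.≤ t
    periodic : IsPeriod m a b t
    minimal  : ∀ s → 1 ℕ.≤ s → IsPeriod m a b s → t ℕ.≤ s

least : ∀ {P : ℕ → Set} → (∀ n → Dec (P n)) → ∀ n → P n →
        ∃ λ k → P k × (∀ j → P j → k ℕ.≤ j)
least {P} P? = <-rec _ step
  where
  step : ∀ n → (∀ {i} → i ℕ.< n → P i → ∃ λ k → P k × (∀ j → P j → k ℕ.≤ j)) →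
         P n → ∃ λ k → P k × (∀ j → P j → k ℕ.≤ j)
  step n rec pn with anyUpTo? P? n
  ... | yes (i , i<n , pi) = rec i<n pi
  ... | no ∄ = n , pn , λ j pj → ≮⇒≥ λ j<n → ∄ (j , j<n , pj)

module _ (m : ℕ) .{{_ : NonZero m}} (a b : ℤ) where

  private
    F : ℕ → ℤ
    F = fib a b

    Agree : ℕ → ℕ → Set
    Agree i j = F i ≋ F j [mod m ] × F (suc i) ≋ F (suc j) [mod m ]

    forward : ∀ t → Agree t 0 → ∀ n → Agree (n ℕ.+ t) n
    forward t h zero    = h
    forward t h (suc n) with forward t h n
    ... | h₀ , h₁ = h₁ ,
      +-cong-≋ {x = F (suc (n ℕ.+ t))} {y = F (suc n)} h₁ h₀

    backward : ∀ i t → Agree (i ℕ.+ t) i → Agree t 0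
    backward zero    t h         = h
    backward (suc i) t (h₀ , h₁) = backward i t
      (+-cancelˡ-≋ {x = F (suc (i ℕ.+ t))} {y = F (suc i)} h₀ h₁ , h₀)

    code : ℕ → Fin (m ℕ.* m)
    code n = combine (residue m (F n)) (residue m (F (suc n)))

    recurrence : ∃ λ t → 1 ℕ.≤ t × Agree t 0
    recurrence with pigeonhole (ℕ.n<1+n (m ℕ.* m)) (λ i → code (toℕ i))
    ... | i , j , i<j , eq
      with ℕ.m≤n⇒∃[o]m+o≡n (ℕ.<⇒≤ i<j)
         | combine-injective _ _ _ _ (sym eq)
    ... | t , i+t≡j | r₀ , r₁ =
      t , ℕ.n≢0⇒n>0 t≢0 , backward (toℕ i) t agree
      where
      t≢0 : ¬ t ≡ 0
      t≢0 refl = ℕ.<⇒≢ i<j (trans (sym (ℕ.+-identityʳ (toℕ i))) i+t≡j)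
      agree : Agree (toℕ i ℕ.+ t) (toℕ i)
      agree = subst (λ k → Agree k (toℕ i)) (sym i+t≡j)
        ( residue-≡⇒≋ m {x = F (toℕ j)} r₀
        , residue-≡⇒≋ m {x = F (suc (toℕ j))} r₁)

    candidate? : ∀ t → Dec (1 ℕ.≤ t × Agree t 0)
    candidate? t = (1 ℕ.≤? t) ×-dec
      ((F t ≋? F 0 [mod m ]) ×-dec (F (suc t) ≋? F 1 [mod m ]))

    leastPeriod : ∀ {t} →
      1 ℕ.≤ t × Agree t 0 → (∀ s → 1 ℕ.≤ s × Agree s 0 → t ℕ.≤ s) →
      IsPisanoPeriod m a b t
    leastPeriod {t} (1≤t , h) min = record
      { positive = 1≤t
      ; periodic = λ n → proj₁ (forward t h n)
      ; minimal  = λ s 1≤s per → min s (1≤s , per 0 , per 1)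
      }

  -- Abstract because unfolding the search makes type checking very slow.
  abstract
    pisano-exists : ∃ (IsPisanoPeriod m a b)
    pisano-exists =
      let t₀ , h₀ = recurrence
          t , h , min = least candidate? t₀ h₀
      in t , leastPeriod h min

------------------------------------------------------------------------
-- Pisano–Legendre primes

record OddPrime : Set where
  field
    value   : ℕ
    isPrime : Prime value
    isOdd   : ¬ 2 ℕ.∣ value

  instance
    nonZero : NonZero value
    nonZero = prime⇒nonZero isPrime

open OddPrime using (value)

π : OddPrime → ℤ → ℤ → ℕ
π p a b = proj₁ (pisano-exists (value p) {{OddPrime.nonZero p}} a b)

π-isPisanoPeriod : ∀ p a b → IsPisanoPeriod (value p) a b (π p a b)
π-isPisanoPeriod p a b =
  proj₂ (pisano-exists (value p) {{OddPrime.nonZero p}} a b)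

IsSquareMod : ℕ → ℤ → Set
IsSquareMod m x = ∃ λ (y : ℤ) → y * y ≋ x [mod m ]

isSquareMod? : ∀ m .{{_ : NonZero m}} x → Dec (IsSquareMod m x)
isSquareMod? m x = map′
  (λ (r , h) → + toℕ r , h)
  (λ (y , h) → residue m y ,
    ≋-trans {x = + toℕ (residue m y) * + toℕ (residue m y)} {y = y * y}
      (≋-sym {x = y * y} (square-cong-≋ {x = y} (residue-≋ m y))) h)
  (Fin.any? λ r → (+ toℕ r * + toℕ r) ≋? x [mod m ])

legendre : ℤ → OddPrime → ℤ
legendre x p with + value p ∣? x
... | yes _ = 0ℤ
... | no  _ with isSquareMod? (value p) {{OddPrime.nonZero p}} x
...   | yes _ = 1ℤ
...   | no  _ = -1ℤ

-- Finite sets are represented by duplicate-free lists, so that their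
-- cardinality is the length.
Λ : ℤ → OddPrime → ℤ → ℤ → List ℕ
Λ j p a b = filter (λ ξ → legendre (fib a b ξ) p ≟ j) (upTo (π p a b))

IsPLPrime : ℤ → OddPrime → ℤ → ℤ → Set
IsPLPrime k p a b =
  k ≡ + length (Λ 1ℤ p a b) - + length (Λ -1ℤ p a b) - + length (Λ 0ℤ p a b)

χ : ℤ → ℤ → Pred ℤ 0ℓ
χ a b k = ∃ λ p → IsPLPrime k p a b

------------------------------------------------------------------------
-- Graphs

-- A graph of order n has vertex set Fin n.
record SimpleConnectedGraph (n : ℕ) : Set₁ where
  field
    Adj         : Rel (Fin n) 0ℓ
    adj?        : Decidable Adj
    symmetric   : Symmetric Adj
    irreflexive : ∀ v → ¬ Adj v v
    nonEmpty    : NonZero n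
    connected   : ∀ u v → Star Adj u v

  -- Each edge {u , v} is listed once, with u < v.
  edges : List (Fin n × Fin n)
  edges = filter (λ (u , v) → (u Fin.<? v) ×-dec adj? u v)
                 (cartesianProduct (allFin n) (allFin n))

-- The labels 0, …, n-1 are the elements of Fin n.
module _ {n : ℕ} (p : OddPrime) (a b : ℤ) (f : Fin n → Fin n) where

  -- The division is exact: the Legendre symbol is ±1 in the second case.
  edgeLabel : Fin n × Fin n → ℤ
  edgeLabel (u , v)
    with fib a b (toℕ (f u)) + fib a b (toℕ (f v)) ≋? 0ℤ [mod value p ]
  ... | yes _ = 0ℤ
  ... | no  _ =
    (1ℤ + legendre (fib a b (toℕ (f u)) + fib a b (toℕ (f v))) p) / + 2

  edgeCount : SimpleConnectedGraph n → ℤ → ℕ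
  edgeCount G i =
    length (filter (λ uv → edgeLabel uv ≟ i) (SimpleConnectedGraph.edges G))

IsFLCLabeling : ∀ {n} → SimpleConnectedGraph n → OddPrime → ℤ → ℤ →
                Fin n ⤖ Fin n → Set
IsFLCLabeling G p a b f =
  ∣ edgeCount p a b (Bijection.to f) G 0ℤ - edgeCount p a b (Bijection.to f) G 1ℤ ∣ ℕ.≤ 1

IsFLCGraph : ∀ {n} → SimpleConnectedGraph n → OddPrime → ℤ → ℤ → Set
IsFLCGraph G p a b = ∃ (IsFLCLabeling G p a b)

-- Vertex zero is the centre x₀; the vertices suc i are the leaves.
data StarAdj {m : ℕ} : Rel (Fin (suc m)) 0ℓ where
  centre-leaf : ∀ i → StarAdj zero (suc i)
  leaf-centre : ∀ i → StarAdj (suc i) zero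

starAdj? : ∀ {m} → Decidable (StarAdj {m})
starAdj? zero    zero    = no λ ()
starAdj? zero    (suc i) = yes (centre-leaf i)
starAdj? (suc i) zero    = yes (leaf-centre i)
starAdj? (suc i) (suc j) = no λ ()

starAdj-connected : ∀ {m} (u v : Fin (suc m)) → Star StarAdj u v
starAdj-connected zero    zero    = ε
starAdj-connected zero    (suc j) = centre-leaf j ◅ ε
starAdj-connected (suc i) zero    = leaf-centre i ◅ ε
starAdj-connected (suc i) (suc j) = leaf-centre i ◅ centre-leaf j ◅ ε

starGraph : ∀ n .{{_ : NonZero n}} → SimpleConnectedGraph n
starGraph (suc m) = record
  { Adj         = StarAdj
  ; adj?        = starAdj?
  ; symmetric   = λ where (centre-leaf i) → leaf-centre i
                          (leaf-centre i) → centre-leaf i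
  ; irreflexive = λ _ ()
  ; nonEmpty    = _
  ; connected   = starAdj-connected
  }

{-# OPTIONS --safe #-}

-- Label the centre 0 and the leaves 1, …, qπ, where π is the Pisano period.
-- As F₀ = 0, the edge to the leaf i is labelled 1 exactly when (Fᵢ/p) = 1.
-- The labels of the leaves form q full periods, and over each of them the
-- 0-PL hypothesis balances the symbols 1 against the symbols -1 and 0.
module Submission where

open import Defs
open import Data.Fin.Base as Fin using (Fin; zero; suc; toℕ)
open import Data.Fin.Properties as Fin using ()
open import Data.Integer.Base as ℤ using (ℤ; +_; 0ℤ; 1ℤ; -1ℤ)
open import Data.Integer.DivMod using (_/_)
open import Data.Integer.Divisibility.Signed using (_∣_; _∣?_; ∣m⇒∣-m; ∣m∣n⇒∣m+n)
open import Data.Integer.Properties as ℤ using (_≟_)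
open import Data.Integer.Tactic.RingSolver using (solve-∀)
open import Data.List.Base
  using (List; []; _∷_; _++_; length; filter; map; tabulate; applyUpTo; upTo;
         allFin; cartesianProduct)
open import Data.List.Membership.Propositional.Properties using (∈-cartesianProduct⁻; ∈-tabulate⁻)
open import Data.List.Properties
  using (filter-++; filter-all; filter-none; ++-identityʳ; map-tabulate)
open import Data.List.Relation.Unary.All as All using (All)
open import Data.List.Relation.Unary.All.Properties using (tabulate⁺)
open import Data.Nat.Base using (ℕ; zero; suc; _≤_; _+_; _*_; z≤n; s≤s)
open import Data.Nat.Properties as ℕ using ()
open import Data.Product.Base using (_×_; _,_)
open import Data.Sum.Base using (_⊎_; inj₁; inj₂)
open import Function.Base using (_∘_; id)
open import Function.Construct.Identity using (⤖-id)
open import Relation.Binary.PropositionalEquality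
  using (_≡_; _≢_; refl; sym; trans; cong; cong₂; subst; module ≡-Reasoning)
open import Relation.Nullary using (¬_; Dec; yes; no; contradiction)
open import Relation.Nullary.Decidable using (_×-dec_)
open import Relation.Unary using (_∈_; Decidable)
open import Algebra.Properties.AbelianGroup ℤ.+-0-abelianGroup using (∙-cancelˡ)

open OddPrime using (value)
open ≡-Reasoning

private
  variable
    A : Set

-- Integer sums over lists and over initial segments of the naturals

∑ : (A → ℤ) → List A → ℤ
∑ f []       = 0ℤ
∑ f (x ∷ xs) = f x ℤ.+ ∑ f xs

∑-cong : ∀ {f g : A → ℤ} → (∀ x → f x ≡ g x) → ∀ xs → ∑ f xs ≡ ∑ g xs
∑-cong f≗g []       = refl
∑-cong f≗g (x ∷ xs) = cong₂ ℤ._+_ (f≗g x) (∑-cong f≗g xs)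

∑-minus : ∀ (f g : A → ℤ) xs → ∑ f xs ℤ.- ∑ g xs ≡ ∑ (λ x → f x ℤ.- g x) xs
∑-minus f g []       = refl
∑-minus f g (x ∷ xs) =
  trans (interchange (f x) (∑ f xs) (g x) (∑ g xs))
        (cong (ℤ._+_ (f x ℤ.- g x)) (∑-minus f g xs))
  where
  interchange : ∀ a b c d → (a ℤ.+ b) ℤ.- (c ℤ.+ d) ≡ (a ℤ.- c) ℤ.+ (b ℤ.- d)
  interchange = solve-∀

-- The recursion removes the first term, as in `applyUpTo` and `tabulate`, so sums over either list
-- convert by a direct induction.
∑< : ℕ → (ℕ → ℤ) → ℤ
∑< zero    f = 0ℤ
∑< (suc n) f = f 0 ℤ.+ ∑< n (f ∘ suc)

∑-applyUpTo : ∀ (f : A → ℤ) g n → ∑ f (applyUpTo g n) ≡ ∑< n (f ∘ g)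
∑-applyUpTo f g zero    = refl
∑-applyUpTo f g (suc n) = cong (ℤ._+_ (f (g 0))) (∑-applyUpTo f (g ∘ suc) n)

∑-tabulate : ∀ {n} {f : A → ℤ} {g : Fin n → A} {h : ℕ → ℤ} →
             (∀ i → f (g i) ≡ h (toℕ i)) → ∑ f (tabulate g) ≡ ∑< n h
∑-tabulate {n = zero}  eq = refl
∑-tabulate {n = suc n} eq = cong₂ ℤ._+_ (eq zero) (∑-tabulate (eq ∘ suc))

∑<-cong : ∀ {f g : ℕ → ℤ} → (∀ i → f i ≡ g i) → ∀ n → ∑< n f ≡ ∑< n g
∑<-cong f≗g zero    = refl
∑<-cong f≗g (suc n) = cong₂ ℤ._+_ (f≗g 0) (∑<-cong (f≗g ∘ suc) n)

∑<-last : ∀ n f → ∑< (suc n) f ≡ ∑< n f ℤ.+ f n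
∑<-last zero    f = ℤ.+-comm (f 0) 0ℤ
∑<-last (suc n) f =
  trans (cong (ℤ._+_ (f 0)) (∑<-last n (f ∘ suc)))
        (sym (ℤ.+-assoc (f 0) (∑< n (f ∘ suc)) (f (suc n))))

-- The offset is added on the right to match the shape `n + t` in `IsPeriod`.
∑<-+ : ∀ m n f → ∑< (m + n) f ≡ ∑< m f ℤ.+ ∑< n (f ∘ (_+ m))
∑<-+ zero    n f = trans (∑<-cong (λ i → cong f (sym (ℕ.+-identityʳ i))) n)
                         (sym (ℤ.+-identityˡ _))
∑<-+ (suc m) n f = begin
  f 0 ℤ.+ ∑< (m + n) (f ∘ suc)
    ≡⟨ cong (ℤ._+_ (f 0)) (∑<-+ m n (f ∘ suc)) ⟩
  f 0 ℤ.+ (∑< m (f ∘ suc) ℤ.+ ∑< n (λ i → f (suc (i + m))))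
    ≡⟨ ℤ.+-assoc (f 0) _ _ ⟨
  f 0 ℤ.+ ∑< m (f ∘ suc) ℤ.+ ∑< n (λ i → f (suc (i + m)))
    ≡⟨ cong (ℤ._+_ (f 0 ℤ.+ ∑< m (f ∘ suc)))
            (∑<-cong (λ i → cong f (sym (ℕ.+-suc i m))) n) ⟩
  f 0 ℤ.+ ∑< m (f ∘ suc) ℤ.+ ∑< n (f ∘ (_+ suc m)) ∎

module _ (t : ℕ) where

  -- Splitting `∑< (suc t) f` at its first and at its last term gives two expressions whose extra
  -- terms agree and cancel. This is needed because the leaf labels start at 1, while the sets `Λ`
  -- count from 0.
  ∑<-shift : ∀ f → f t ≡ f 0 → ∑< t (f ∘ suc) ≡ ∑< t f
  ∑<-shift f ft≡f0 = ∙-cancelˡ (f 0) _ _ (begin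
    f 0 ℤ.+ ∑< t (f ∘ suc) ≡⟨ ∑<-last t f ⟩
    ∑< t f ℤ.+ f t         ≡⟨ cong (ℤ._+_ (∑< t f)) ft≡f0 ⟩
    ∑< t f ℤ.+ f 0         ≡⟨ ℤ.+-comm (∑< t f) (f 0) ⟩
    f 0 ℤ.+ ∑< t f         ∎)

  -- Induction on `q`: the first period contributes 0, and by periodicity what remains is the sum
  -- over `q` periods.
  ∑<-periods : ∀ f → (∀ i → f (i + t) ≡ f i) → ∑< t f ≡ 0ℤ →
               ∀ q → ∑< (q * t) f ≡ 0ℤ
  ∑<-periods f periodic ∑≡0 zero    = refl
  ∑<-periods f periodic ∑≡0 (suc q) = trans (∑<-+ t (q * t) f)
    (cong₂ ℤ._+_ ∑≡0
      (trans (∑<-cong periodic (q * t)) (∑<-periods f periodic ∑≡0 q)))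

𝟙 : ∀ {P : Set} → Dec P → ℤ
𝟙 (yes _) = 1ℤ
𝟙 (no _)  = 0ℤ

-- Turns cardinalities into sums of indicators, so that differences of counts can be compared term
-- by term.
length-filter : ∀ {P : A → Set} (P? : Decidable P) xs →
                + length (filter P? xs) ≡ ∑ (𝟙 ∘ P?) xs
length-filter P? []       = refl
length-filter P? (x ∷ xs) with P? x
... | yes _ = cong (ℤ._+_ 1ℤ) (length-filter P? xs)
... | no  _ = trans (length-filter P? xs) (sym (ℤ.+-identityˡ _))

-- Legendre symbols and the sum of signs over a period

-- Divisibility by `p` and being a square mod `p` both transfer along the congruence, so every mixed
-- case is contradictory.
legendre-cong : ∀ p {x y} → x ≋ y [mod value p ] → legendre x p ≡ legendre y p
legendre-cong p {x} {y} x≋y with + value p ∣? x | + value p ∣? y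
... | yes _   | yes _   = refl
... | yes p∣x | no  p∤y =
  contradiction (subst (+ value p ∣_) (lem x y) (∣m∣n⇒∣m+n (∣m⇒∣-m x≋y) p∣x)) p∤y
  where
  lem : ∀ x y → ℤ.- (x ℤ.- y) ℤ.+ x ≡ y
  lem = solve-∀
... | no  p∤x | yes p∣y =
  contradiction (subst (+ value p ∣_) (lem x y) (∣m∣n⇒∣m+n x≋y p∣y)) p∤x
  where
  lem : ∀ x y → (x ℤ.- y) ℤ.+ y ≡ x
  lem = solve-∀
... | no  _   | no  _
  with isSquareMod? (value p) {{OddPrime.nonZero p}} x
     | isSquareMod? (value p) {{OddPrime.nonZero p}} y
...   | yes _        | yes _ = refl
...   | no  _        | no  _ = refl
...   | yes (z , z²) | no ¬□ =
  contradiction (z , ≋-trans {x = z ℤ.* z} {y = x} {z = y} z² x≋y) ¬□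
...   | no ¬□        | yes (z , z²) =
  contradiction (z , ≋-trans {x = z ℤ.* z} {y = y} {z = x} z² (≋-sym {x = x} x≋y)) ¬□

legendre-∣ : ∀ p {x} → + value p ∣ x → legendre x p ≡ 0ℤ
legendre-∣ p {x} p∣x with + value p ∣? x
... | yes _   = refl
... | no  p∤x = contradiction p∣x p∤x

legendre-∤ : ∀ p {x} → ¬ + value p ∣ x → legendre x p ≡ 1ℤ ⊎ legendre x p ≡ -1ℤ
legendre-∤ p {x} p∤x with + value p ∣? x
... | yes p∣x = contradiction p∣x p∤x
... | no  _   with isSquareMod? (value p) {{OddPrime.nonZero p}} x
...   | yes _ = inj₁ refl
...   | no  _ = inj₂ refl

-- |Λ₁| - |Λ₋₁| - |Λ₀| is the sum of sign (F_ξ/p) over one period.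
sign : ℤ → ℤ
sign j = 𝟙 (j ≟ 1ℤ) ℤ.- 𝟙 (j ≟ -1ℤ) ℤ.- 𝟙 (j ≟ 0ℤ)

∑-sign-legendre : ∀ k p a b → IsPLPrime k p a b →
  ∑< (π p a b) (λ ξ → sign (legendre (fib a b ξ) p)) ≡ k
∑-sign-legendre k p a b pl = begin
  ∑< (π p a b) (sign ∘ L)
    ≡⟨ ∑-applyUpTo (sign ∘ L) id (π p a b) ⟨
  ∑ (sign ∘ L) Ξ
    ≡⟨ ∑-minus (λ ξ → 𝟙 (L ξ ≟ 1ℤ) ℤ.- 𝟙 (L ξ ≟ -1ℤ)) (count 0ℤ) Ξ ⟨
  ∑ (λ ξ → 𝟙 (L ξ ≟ 1ℤ) ℤ.- 𝟙 (L ξ ≟ -1ℤ)) Ξ ℤ.- ∑ (count 0ℤ) Ξ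
    ≡⟨ cong (ℤ._- ∑ (count 0ℤ) Ξ) (∑-minus (count 1ℤ) (count -1ℤ) Ξ) ⟨
  ∑ (count 1ℤ) Ξ ℤ.- ∑ (count -1ℤ) Ξ ℤ.- ∑ (count 0ℤ) Ξ
    ≡⟨ cong₂ ℤ._-_ (cong₂ ℤ._-_ (card 1ℤ) (card -1ℤ)) (card 0ℤ) ⟨
  + length (Λ 1ℤ p a b) ℤ.- + length (Λ -1ℤ p a b) ℤ.- + length (Λ 0ℤ p a b)
    ≡⟨ pl ⟨
  k ∎
  where
  Ξ = upTo (π p a b)
  L : ℕ → ℤ
  L ξ = legendre (fib a b ξ) p
  count : ℤ → ℕ → ℤ
  count j ξ = 𝟙 (L ξ ≟ j)
  card : ∀ j → + length (Λ j p a b) ≡ ∑ (count j) Ξ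
  card j = length-filter (λ ξ → L ξ ≟ j) Ξ

-- Edges of the star and their labels

starGraph-edges : ∀ m → SimpleConnectedGraph.edges (starGraph (suc m)) ≡
                        tabulate (λ i → zero , suc i)
starGraph-edges m = begin
  -- The pair `(zero , zero)` heads the product, but the filter drops it by computation. Of the
  -- others, pairs starting at the centre are all kept and pairs starting at a leaf, collected in
  -- `rest`, are all dropped.
  filter edge? (map (zero ,_) (tabulate suc) ++ rest)
    ≡⟨ filter-++ edge? (map (zero ,_) (tabulate suc)) rest ⟩
  filter edge? (map (zero ,_) (tabulate suc)) ++ filter edge? rest
    ≡⟨ cong₂ _++_ (cong (filter edge?) (map-tabulate suc (zero ,_)))
                  (filter-none edge? none) ⟩
  filter edge? (tabulate (λ i → zero , suc i)) ++ []
    ≡⟨ ++-identityʳ _ ⟩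
  filter edge? (tabulate (λ i → zero , suc i))
    ≡⟨ filter-all edge? (tabulate⁺ λ i → s≤s z≤n , centre-leaf i) ⟩
  tabulate (λ i → zero , suc i) ∎
  where
  Edge : Fin (suc m) × Fin (suc m) → Set
  Edge (u , v) = u Fin.< v × StarAdj u v
  edge? : Decidable Edge
  edge? (u , v) = (u Fin.<? v) ×-dec starAdj? u v
  rest = cartesianProduct (tabulate suc) (allFin (suc m))
  -- A leaf is adjacent only to the centre `zero`, which is not above it in the order.
  not-edge : ∀ i v → ¬ Edge (suc i , v)
  not-edge i _ (() , leaf-centre i)
  none : All (¬_ ∘ Edge) rest
  none = All.tabulate λ {(u , v)} uv∈ →
    let u∈ , _ = ∈-cartesianProduct⁻ (tabulate suc) (allFin (suc m)) uv∈
        i , u≡ = ∈-tabulate⁻ u∈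
    in λ e → not-edge i v (subst (λ u → Edge (u , v)) u≡ e)

-- The formula for a sum not divisible by `p`, as a function of its symbol `l`. Once `l` is 1 or -1
-- it computes to the same value as `sign l`.
labelSign : ℤ → ℤ
labelSign l = 𝟙 ((1ℤ ℤ.+ l) / + 2 ≟ 1ℤ) ℤ.- 𝟙 ((1ℤ ℤ.+ l) / + 2 ≟ 0ℤ)

-- The label 0 covers both the symbol -1 and the symbol 0, which are the two symbols that `sign`
-- counts negatively.
edgeLabel-sign : ∀ {n} p a b (f : Fin n → Fin n) u v →
  𝟙 (edgeLabel p a b f (u , v) ≟ 1ℤ) ℤ.- 𝟙 (edgeLabel p a b f (u , v) ≟ 0ℤ) ≡
  sign (legendre (fib a b (toℕ (f u)) ℤ.+ fib a b (toℕ (f v))) p)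
edgeLabel-sign p a b f u v
  with fib a b (toℕ (f u)) ℤ.+ fib a b (toℕ (f v)) ≋? 0ℤ [mod value p ]
... | yes x≋0 =
  sym (cong sign (legendre-∣ p (subst (+ value p ∣_) (ℤ.+-identityʳ _) x≋0)))
... | no x≋̸0
  with legendre-∤ p (x≋̸0 ∘ subst (+ value p ∣_) (sym (ℤ.+-identityʳ _)))
...   | inj₁ ≡1  = trans (cong labelSign ≡1) (sym (cong sign ≡1))
...   | inj₂ ≡-1 = trans (cong labelSign ≡-1) (sym (cong sign ≡-1))

theorem3p2 : (b : ℤ) → b ≢ 0ℤ → 0ℤ ∈ χ 0ℤ b →
    (p : OddPrime) → IsPLPrime 0ℤ p 0ℤ b →
    (q : ℕ) → 1 ≤ q → IsFLCGraph (starGraph (1 + q * π p 0ℤ b)) p 0ℤ b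
-- The identity is the required labelling, since vertex `zero` is the centre.
theorem3p2 b _ _ p pl q _ = ⤖-id _ ,
  subst (_≤ 1) (sym (ℕ.m≡n⇒∣m-n∣≡0 (sym e₁≡e₀))) z≤n
  where
  t = π p 0ℤ b
  G = starGraph (1 + q * t)
  E = SimpleConnectedGraph.edges G

  label : Fin (1 + q * t) × Fin (1 + q * t) → ℤ
  label = edgeLabel p 0ℤ b id

  s : ℕ → ℤ
  s ξ = sign (legendre (fib 0ℤ b ξ) p)

  s-periodic : ∀ i → s (i + t) ≡ s i
  s-periodic i = cong sign (legendre-cong p
    (IsPisanoPeriod.periodic (π-isPisanoPeriod p 0ℤ b) i))

  label-sign : ∀ i → 𝟙 (label (zero , suc i) ≟ 1ℤ) ℤ.- 𝟙 (label (zero , suc i) ≟ 0ℤ)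
                     ≡ s (suc (toℕ i))
  label-sign i = trans (edgeLabel-sign p 0ℤ b id zero (suc i))
    (cong (λ x → sign (legendre x p)) (ℤ.+-identityˡ (fib 0ℤ b (suc (toℕ i)))))

  balanced : + edgeCount p 0ℤ b id G 1ℤ ℤ.- + edgeCount p 0ℤ b id G 0ℤ ≡ 0ℤ
  balanced = begin
    + edgeCount p 0ℤ b id G 1ℤ ℤ.- + edgeCount p 0ℤ b id G 0ℤ
      ≡⟨ cong₂ ℤ._-_ (length-filter (λ e → label e ≟ 1ℤ) E)
                     (length-filter (λ e → label e ≟ 0ℤ) E) ⟩
    ∑ (λ e → 𝟙 (label e ≟ 1ℤ)) E ℤ.- ∑ (λ e → 𝟙 (label e ≟ 0ℤ)) E
      ≡⟨ ∑-minus _ _ E ⟩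
    ∑ (λ e → 𝟙 (label e ≟ 1ℤ) ℤ.- 𝟙 (label e ≟ 0ℤ)) E
      ≡⟨ cong (∑ _) (starGraph-edges (q * t)) ⟩
    ∑ (λ e → 𝟙 (label e ≟ 1ℤ) ℤ.- 𝟙 (label e ≟ 0ℤ)) (tabulate (λ i → zero , suc i))
      ≡⟨ ∑-tabulate label-sign ⟩
    ∑< (q * t) (s ∘ suc)
      -- The leaves run through `q` periods starting at index 1. Shifting one period back to index 0
      -- gives the sum that the 0-PL hypothesis makes vanish.
      ≡⟨ ∑<-periods t (s ∘ suc) (s-periodic ∘ suc)
           (trans (∑<-shift t s (s-periodic 0)) (∑-sign-legendre 0ℤ p 0ℤ b pl)) q ⟩
    0ℤ ∎

  e₁≡e₀ : edgeCount p 0ℤ b id G 1ℤ ≡ edgeCount p 0ℤ b id G 0ℤ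
  e₁≡e₀ = ℤ.+-injective (ℤ.i-j≡0⇒i≡j (+ edgeCount p 0ℤ b id G 1ℤ) _ balanced)
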